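{- Let $m\ge 2$ be an integer and let $n$ be a positive integer with $m^j\le n<m^{j+1}$ for some integer $j\ge 0$, with base $m$ representation $n=\alpha_j m^j+\cdots+\alpha_1 m+\alpha_0$ ($\alpha_j>0$, $0\le\alpha_i\le m-1$). For $1\le i\le j$ let $\chi_i=0$ if $\alpha_{i-1}>0$ and $\chi_i=1$ if $\alpha_{i-1}=0$. Then \[ c_m(mn)\equiv \alpha_0+(\alpha_0-1)\sum_{i=1}^{j}(\alpha_1-\chi_1)(\alpha_2-\chi_2)\cdots(\alpha_i-\chi_i)\pmod m. \]
   Context: An $m$-ary partition of a positive integer $N$ is a partition of $N$ in which every part is a power of $m$. It is without gaps if, whenever $m^i$ is its largest part, every $m^k$ with $0\le k<i$ also appears as a part. $c_m(N)$ denotes the number of $m$-ary partitions of $N$ without gaps. -}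

module Defs where

open import Data.Empty using (⊥)
open import Data.Fin.Base using (toℕ)
open import Data.Integer.Base as ℤ using (ℤ; +_; 0ℤ; 1ℤ)
import Data.Integer.Properties as ℤₚ
open import Data.Integer.Divisibility.Signed as ℤ∣ using ()
open import Data.List.Base
  using (List; []; _∷_; length; filter; upTo; cartesianProductWith)
open import Data.List.Membership.Propositional using (_∈_)
import Data.List.Membership.DecPropositional as DecMembership
open import Data.List.Membership.Propositional.Properties
  using (∈-filter⁺; ∈-filter⁻; ∈-upTo⁺; ∈-cartesianProductWith⁺; ∈-cartesianProductWith⁻)
open import Data.List.Properties using (∷-injective)
open import Data.List.Relation.Unary.All using (All; []; _∷_; all?; tabulate)
open import Data.List.Relation.Unary.AllPairs using ([]; _∷_)
open import Data.List.Relation.Unary.Any using (here; there)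
open import Data.List.Relation.Unary.Linked using (Linked; linked?)
open import Data.List.Relation.Unary.Unique.Propositional using (Unique)
import Data.List.Relation.Unary.Unique.Propositional.Properties as Uniqueₚ
open import Data.Nat.Base
open import Data.Nat.ListAction using (sum)
open import Data.Nat.Properties
open import Data.Product.Base using (∃; _×_; _,_; proj₁; proj₂)
open import Function.Base using (_∘_)
open import Function.Bundles using (_⇔_; mk⇔)
open import Relation.Binary.PropositionalEquality.Core using (_≡_; refl; sym; subst)
open import Relation.Nullary.Decidable using (Dec; map′; _×-dec_; _→-dec_)

open DecMembership _≟_ using (_∈?_)

import Algebra.Properties.CommutativeMonoid.Sum as BigOp
private
  module Σℕ = BigOp +-0-commutativeMonoid
  module Σℤ = BigOp ℤₚ.+-0-commutativeMonoid
  module Πℤ = BigOp ℤₚ.*-1-commutativeMonoid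

-- Partitions are listed with their parts in weakly decreasing order, so
-- that distinct lists are distinct partitions.
record IsPartition (N : ℕ) (ps : List ℕ) : Set where
  constructor mkPartition
  field
    positive   : All (0 <_) ps
    decreasing : Linked _≥_ ps
    total      : sum ps ≡ N

IsPowerOf : ℕ → ℕ → Set
IsPowerOf m p = ∃ λ k → p ≡ m ^ k

IsLargestPart : ℕ → List ℕ → Set
IsLargestPart p ps = p ∈ ps × All (_≤ p) ps

WithoutGaps : ℕ → List ℕ → Set
WithoutGaps m ps = ∀ i → IsLargestPart (m ^ i) ps → ∀ k → k < i → m ^ k ∈ ps

record IsGapFreeMAryPartition (m N : ℕ) (ps : List ℕ) : Set where
  constructor mkGapFree
  field
    isPartition : IsPartition N ps
    mary        : All (IsPowerOf m) ps
    withoutGaps : WithoutGaps m ps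

isPartition? : ∀ N ps → Dec (IsPartition N ps)
isPartition? N ps =
  map′ (λ { (a , b , c) → mkPartition a b c })
       (λ { (mkPartition a b c) → a , b , c })
       (all? (0 <?_) ps ×-dec linked? _≥?_ ps ×-dec (sum ps ≟ N))

k<m^k : ∀ m .{{_ : NonTrivial m}} k → k < m ^ k
k<m^k m zero    = s≤s z≤n
k<m^k m (suc k) =
  ≤-<-trans (k<m^k m k) (^-monoʳ-< m (nonTrivial⇒n>1 m) (n<1+n k))

isPowerOf? : ∀ m .{{_ : NonTrivial m}} p → Dec (IsPowerOf m p)
isPowerOf? m p =
  map′ (λ { (k , _ , eq) → k , eq })
       (λ { (k , refl) → k , k<m^k m k , refl })
       (anyUpTo? (λ k → p ≟ m ^ k) p)

∈⇒≤sum : ∀ {p ps} → p ∈ ps → p ≤ sum ps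
∈⇒≤sum {ps = q ∷ ps} (here refl) = m≤m+n q (sum ps)
∈⇒≤sum {ps = q ∷ ps} (there p∈)  = ≤-trans (∈⇒≤sum p∈) (m≤n+m (sum ps) q)

withoutGaps? : ∀ m .{{_ : NonTrivial m}} ps → Dec (WithoutGaps m ps)
withoutGaps? m ps =
  map′ (λ f i lg k k<i → f (<-≤-trans (k<m^k m i) (∈⇒≤sum (proj₁ lg))) lg k<i)
       (λ g {i} _ lg {k} k<i → g i lg k k<i)
       (allUpTo? (λ i → largest? (m ^ i) →-dec allUpTo? (λ k → m ^ k ∈? ps) i) (sum ps))
  where
  largest? : ∀ p → Dec (IsLargestPart p ps)
  largest? p = (p ∈? ps) ×-dec all? (_≤? p) ps

isGapFree? : ∀ m .{{_ : NonTrivial m}} N ps → Dec (IsGapFreeMAryPartition m N ps)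
isGapFree? m N ps =
  map′ (λ { (a , b , c) → mkGapFree a b c })
       (λ { (mkGapFree a b c) → a , b , c })
       (isPartition? N ps ×-dec all? (isPowerOf? m) ps ×-dec withoutGaps? m ps)

-- Lists of length at most l over xs, without repetition if xs has none.
lists≤ : ℕ → List ℕ → List (List ℕ)
lists≤ zero    xs = [] ∷ []
lists≤ (suc l) xs = [] ∷ cartesianProductWith _∷_ xs (lists≤ l xs)

-- Every partition of N has at most N parts, each of them at most N.
gapFreePartitions : ∀ m .{{_ : NonTrivial m}} → ℕ → List (List ℕ)
gapFreePartitions m N = filter (isGapFree? m N) (lists≤ N (upTo (suc N)))

-- That this counts each gap-free partition exactly once is
-- gapFreePartitions-unique together with ∈-gapFreePartitions.
c : ∀ m .{{_ : NonTrivial m}} → ℕ → ℕ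
c m N = length (gapFreePartitions m N)

lists≤-unique : ∀ l {xs} → Unique xs → Unique (lists≤ l xs)
lists≤-unique zero    u = [] ∷ []
lists≤-unique (suc l) {xs} u =
  tabulate (λ v∈ []≡v → []∉ (subst (_∈ _) (sym []≡v) v∈))
  ∷ Uniqueₚ.cartesianProductWith⁺ _∷_ ∷-injective u (lists≤-unique l u)
  where
  []∉ : [] ∈ cartesianProductWith _∷_ xs (lists≤ l xs) → ⊥
  []∉ p with ∈-cartesianProductWith⁻ _∷_ xs (lists≤ l xs) p
  ... | _ , _ , _ , _ , ()

∈-lists≤ : ∀ l {xs ps} → length ps ≤ l → All (_∈ xs) ps → ps ∈ lists≤ l xs
∈-lists≤ zero    {ps = []}    _         _        = here refl
∈-lists≤ (suc l) {ps = []}    _         _        = here refl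
∈-lists≤ (suc l) {ps = _ ∷ _} (s≤s len) (p ∷ ps) =
  there (∈-cartesianProductWith⁺ _∷_ p (∈-lists≤ l len ps))

length≤sum : ∀ {ps} → All (0 <_) ps → length ps ≤ sum ps
length≤sum []       = z≤n
length≤sum (p ∷ ps) = +-mono-≤ p (length≤sum ps)

gapFreePartitions-unique : ∀ m .{{_ : NonTrivial m}} N → Unique (gapFreePartitions m N)
gapFreePartitions-unique m N =
  Uniqueₚ.filter⁺ (isGapFree? m N) (lists≤-unique N (Uniqueₚ.upTo⁺ (suc N)))

∈-gapFreePartitions : ∀ m .{{_ : NonTrivial m}} N ps →
  ps ∈ gapFreePartitions m N ⇔ IsGapFreeMAryPartition m N ps
∈-gapFreePartitions m N ps = mk⇔
  (λ ps∈ → proj₂ (∈-filter⁻ (isGapFree? m N) {xs = lists≤ N (upTo (suc N))} ps∈))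
  (λ g → ∈-filter⁺ (isGapFree? m N) (candidate (IsGapFreeMAryPartition.isPartition g)) g)
  where
  candidate : ∀ {ps} → IsPartition N ps → ps ∈ lists≤ N (upTo (suc N))
  candidate (mkPartition pos _ refl) =
    ∈-lists≤ N (length≤sum pos) (tabulate (∈-upTo⁺ ∘ s≤s ∘ ∈⇒≤sum))

∑⟨0⋯_⟩ : ℕ → (ℕ → ℕ) → ℕ
∑⟨0⋯ j ⟩ f = Σℕ.sum {suc j} (λ i → f (toℕ i))

∑⟨1⋯_⟩ : ℕ → (ℕ → ℤ) → ℤ
∑⟨1⋯ j ⟩ f = Σℤ.sum {j} (λ i → f (suc (toℕ i)))

-- The library's sum over the monoid (ℤ, *, 1) is a product.
∏⟨1⋯_⟩ : ℕ → (ℕ → ℤ) → ℤ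
∏⟨1⋯ j ⟩ f = Πℤ.sum {j} (λ i → f (suc (toℕ i)))

-- Only used for indices i ≥ 1, where i ∸ 1 is a genuine predecessor.
χ : (ℕ → ℕ) → ℕ → ℤ
χ α i with α (i ∸ 1)
... | zero  = 1ℤ
... | suc _ = 0ℤ

infix 4 _≡_[mod_]
_≡_[mod_] : ℤ → ℤ → ℕ → Set
a ≡ b [mod m ] = + m ℤ∣.∣ a ℤ.- b

module Submission where

-- Removing the ones from a gap-free m-ary partition of mn + t + 1 (0 ≤ t < m)
-- and dividing the other parts by m leaves a gap-free partition of some k ≤ n.
-- Hence c(mn + t + 1) = S(n + 1) with S(n) = c(0) + ⋯ + c(n − 1), and summing
-- over blocks of length m gives S(mn + t + 1) ≡ 1 + t S(n + 1) (mod m) for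
-- 0 ≤ t ≤ m. Iterating this from c(mn) = S(n) strips one base m digit at a
-- time: S is evaluated at ⌊n / mⁱ⌋, plus one when the digit just removed is
-- positive, which accounts for χ. The nested products that result are the
-- Horner form of the sum of products.

open import Defs
open import Data.Nat using (ℕ; suc; _*_; _^_; _≤_; _<_; NonTrivial)
open import Data.Integer as ℤ using (+_; 1ℤ)
open import Relation.Binary.PropositionalEquality using (_≡_)

open import Data.Empty using (⊥-elim)
open import Data.Fin.Base using (toℕ)
open import Data.Integer.Base using (ℤ)
import Data.Integer.Properties as ℤₚ
open import Data.Integer.Divisibility.Signed using (divides)
open import Data.Integer.Tactic.RingSolver using (solve-∀)
open import Data.List.Base using (List; []; _∷_; _++_; length; map; replicate)
open import Data.List.Membership.Propositional using (_∈_)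
open import Data.List.Membership.Propositional.Properties using (∈-map⁺; ∈-map⁻; ∈-++⁺ˡ; ∈-++⁺ʳ; ∈-++⁻)
open import Data.List.Properties using (length-++; length-map; ∷-injective)
open import Data.List.Relation.Binary.Permutation.Propositional.Properties using (↭-length)
open import Data.List.Membership.Propositional.Properties.WithK using (unique∧set⇒bag)
open import Data.List.Relation.Binary.BagAndSetEquality using (∼bag⇒↭)
open import Data.List.Relation.Unary.All as All using (All; []; _∷_)
import Data.List.Relation.Unary.All.Properties as Allₚ
open import Data.List.Relation.Unary.AllPairs as AllPairs using (AllPairs; []; _∷_)
import Data.List.Relation.Unary.AllPairs.Properties as AllPairsₚ
open import Data.List.Relation.Unary.Any using (here; there)
open import Data.List.Relation.Unary.Linked.Properties using (Linked⇒AllPairs; AllPairs⇒Linked)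
open import Data.List.Relation.Unary.Unique.Propositional using (Unique)
import Data.List.Relation.Unary.Unique.Propositional.Properties as Uniqueₚ
open import Data.Nat.Base using (zero; _+_; _∸_; _≥_; z≤n; s≤s; NonZero; nonTrivial⇒nonZero; nonTrivial⇒n>1)
open import Data.Nat.ListAction using (sum)
open import Data.Nat.ListAction.Properties using (sum-++)
open import Data.Nat.Properties
open import Data.Product.Base using (∃; ∃₂; _×_; _,_; proj₁; proj₂)
open import Data.Sum.Base using (inj₁; inj₂)
open import Function.Base using (_∘_; flip)
open import Function.Bundles using (mk⇔; Equivalence)
open import Relation.Binary.PropositionalEquality using (refl; sym; trans; cong; cong₂; subst; module ≡-Reasoning)
open import Relation.Nullary using (¬_)

import Algebra.Properties.CommutativeMonoid.Sum as CommutativeMonoidSum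
import Algebra.Properties.Semiring.Sum as SemiringSum
private
  module Σℕ = SemiringSum +-*-semiring
  module Σℤ = SemiringSum ℤₚ.+-*-semiring
  module Πℤ = CommutativeMonoidSum ℤₚ.*-1-commutativeMonoid

open IsPartition
open IsGapFreeMAryPartition

-- Lists of ones and scaled lists

All-1⇒replicate : ∀ {xs} → All (_≡ 1) xs → xs ≡ replicate (length xs) 1
All-1⇒replicate []          = refl
All-1⇒replicate (refl ∷ xs) = cong (1 ∷_) (All-1⇒replicate xs)

∈-replicate⁻ : ∀ a {x y : ℕ} → x ∈ replicate a y → x ≡ y
∈-replicate⁻ (suc a) (here eq)  = eq
∈-replicate⁻ (suc a) (there x∈) = ∈-replicate⁻ a x∈

∈-replicate⁺ : ∀ {a} {x : ℕ} → 0 < a → x ∈ replicate a x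
∈-replicate⁺ {suc a} _ = here refl

replicate-≥ : ∀ a x → AllPairs _≥_ (replicate a x)
replicate-≥ zero    x = []
replicate-≥ (suc a) x = Allₚ.replicate⁺ a ≤-refl ∷ replicate-≥ a x

sum-map-* : ∀ m xs → sum (map (m *_) xs) ≡ m * sum xs
sum-map-* m []       = sym (*-zeroʳ m)
sum-map-* m (x ∷ xs) =
  trans (cong (_+_ (m * x)) (sum-map-* m xs)) (sym (*-distribˡ-+ m x (sum xs)))

sum-replicate-1 : ∀ a → sum (replicate a 1) ≡ a
sum-replicate-1 zero    = refl
sum-replicate-1 (suc a) = cong suc (sum-replicate-1 a)

greatest : ∀ {x xs} → AllPairs _≥_ (x ∷ xs) → IsLargestPart x (x ∷ xs)
greatest (x≥ ∷ _) = here refl , ≤-refl ∷ x≥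

-- Base m digits, Horner form and carries

-- The second argument counts digits, so a leading digit `α j` calls for `suc j`. For digits below
-- `m`, passing to `α ∘ suc` is division by `m` with remainder dropped.
value : ℕ → ℕ → (ℕ → ℕ) → ℕ
value m zero    α = 0
value m (suc j) α = m * value m j (α ∘ suc) + α 0

value-∑ : ∀ m j α → Σℕ.sum {j} (λ i → α (toℕ i) * m ^ toℕ i) ≡ value m j α
value-∑ m zero    α = refl
value-∑ m (suc j) α = begin
  α 0 * 1 + Σℕ.sum {j} (λ i → α (suc (toℕ i)) * (m * m ^ toℕ i))
    ≡⟨ cong₂ _+_ (*-identityʳ (α 0)) (Σℕ.sum-cong-≗ {j} (λ i → swap (α (suc (toℕ i))) (m ^ toℕ i))) ⟩
  α 0 + Σℕ.sum {j} (λ i → m * (α (suc (toℕ i)) * m ^ toℕ i))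
    ≡⟨ cong (_+_ (α 0)) (Σℕ.*-distribˡ-sum {j} m (λ i → α (suc (toℕ i)) * m ^ toℕ i)) ⟨
  α 0 + m * Σℕ.sum {j} (λ i → α (suc (toℕ i)) * m ^ toℕ i)
    ≡⟨ cong (λ v → α 0 + m * v) (value-∑ m j (α ∘ suc)) ⟩
  α 0 + m * value m j (α ∘ suc)
    ≡⟨ +-comm (α 0) _ ⟩
  m * value m j (α ∘ suc) + α 0 ∎
  where
  open ≡-Reasoning
  swap : ∀ x y → x * (m * y) ≡ m * (x * y)
  swap x y = trans (sym (*-assoc x m y)) (trans (cong (_* y) (*-comm x m)) (*-assoc m x y))

value>0 : ∀ m .{{_ : NonZero m}} j α → 0 < α j → 0 < value m (suc j) α
value>0 m zero    α αj>0 = <-≤-trans αj>0 (m≤n+m (α 0) (m * 0))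
value>0 m (suc j) α αj>0 = <-≤-trans (value>0 m j (α ∘ suc) αj>0)
  (≤-trans (m≤n*m _ m) (m≤m+n _ (α 0)))

horner : ℕ → (ℕ → ℤ) → ℤ
horner zero    w = 1ℤ
horner (suc j) w = 1ℤ ℤ.+ w 0 ℤ.* horner j (w ∘ suc)

-- Every product in the sum starts with `w 0`. Once it is pulled out, the one-factor product leaves
-- the 1 with which the shifted expression begins.
horner-∑∏ : ∀ j w →
  1ℤ ℤ.+ Σℤ.sum {j} (λ i → Πℤ.sum {suc (toℕ i)} (λ k → w (toℕ k))) ≡ horner j w
horner-∑∏ zero    w = refl
horner-∑∏ (suc j) w = cong (ℤ._+_ 1ℤ) (begin
  w 0 ℤ.* 1ℤ ℤ.+ Σℤ.sum {j} (λ i → w 0 ℤ.* ∏′ (suc (toℕ i)))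
    ≡⟨ cong (ℤ._+_ (w 0 ℤ.* 1ℤ)) (Σℤ.*-distribˡ-sum {j} (w 0) (λ i → ∏′ (suc (toℕ i)))) ⟨
  w 0 ℤ.* 1ℤ ℤ.+ w 0 ℤ.* Σℤ.sum {j} (λ i → ∏′ (suc (toℕ i)))
    ≡⟨ ℤₚ.*-distribˡ-+ (w 0) 1ℤ _ ⟨
  w 0 ℤ.* (1ℤ ℤ.+ Σℤ.sum {j} (λ i → ∏′ (suc (toℕ i))))
    ≡⟨ cong (ℤ._*_ (w 0)) (horner-∑∏ j (w ∘ suc)) ⟩
  w 0 ℤ.* horner j (w ∘ suc) ∎)
  where
  open ≡-Reasoning
  ∏′ : ℕ → ℤ
  ∏′ i = Πℤ.sum {i} (λ k → w (suc (toℕ k)))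

-- The term 1 − χ_i of the i-th factor: whether the previous digit rounds up.
carry : ℕ → ℕ
carry zero    = 0
carry (suc _) = 1

factor : ℕ → ℕ → ℤ
factor p s = + s ℤ.- (1ℤ ℤ.- + carry p)

-- Indexed from 0: entry `i` is α_{i+1} - χ_{i+1}.
factors : (ℕ → ℕ) → ℕ → ℤ
factors α i = factor (α i) (α (suc i))

χ-carry : ∀ α i → χ α (suc i) ≡ 1ℤ ℤ.- + carry (α i)
χ-carry α i with α i
... | zero  = refl
... | suc _ = refl

-- Substitution into affine congruences

affine-mod : ∀ {m} x y h w → x ≡ 1ℤ ℤ.+ w ℤ.* y [mod m ] → y ≡ h [mod m ] →
  x ≡ 1ℤ ℤ.+ w ℤ.* h [mod m ]
affine-mod {m} x y h w (divides q eq) (divides r eq′) = divides (q ℤ.+ w ℤ.* r) (begin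
  x ℤ.- (1ℤ ℤ.+ w ℤ.* h)                                       ≡⟨ split x y h w ⟩
  (x ℤ.- (1ℤ ℤ.+ w ℤ.* y)) ℤ.+ w ℤ.* (y ℤ.- h)                 ≡⟨ cong₂ (λ a b → a ℤ.+ w ℤ.* b) eq eq′ ⟩
  q ℤ.* + m ℤ.+ w ℤ.* (r ℤ.* + m)                              ≡⟨ collect q w r (+ m) ⟩
  (q ℤ.+ w ℤ.* r) ℤ.* + m                                      ∎)
  where
  open ≡-Reasoning
  split : ∀ x y h w → x ℤ.- (1ℤ ℤ.+ w ℤ.* h) ≡ (x ℤ.- (1ℤ ℤ.+ w ℤ.* y)) ℤ.+ w ℤ.* (y ℤ.- h)
  split = solve-∀
  collect : ∀ q w r m → q ℤ.* m ℤ.+ w ℤ.* (r ℤ.* m) ≡ (q ℤ.+ w ℤ.* r) ℤ.* m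
  collect = solve-∀

-- By commutativity this is `affine-mod` with slope and argument exchanged; it serves to replace the
-- slope m - 1 by -1.
slope-mod : ∀ {m} x y w v → x ≡ 1ℤ ℤ.+ w ℤ.* y [mod m ] → w ≡ v [mod m ] →
  x ≡ 1ℤ ℤ.+ v ℤ.* y [mod m ]
slope-mod {m} x y w v x≡ w≡v = subst (λ z → x ≡ 1ℤ ℤ.+ z [mod m ]) (ℤₚ.*-comm y v)
  (affine-mod x w v y (subst (λ z → x ≡ 1ℤ ℤ.+ z [mod m ]) (ℤₚ.*-comm w y) x≡) w≡v)

-- Removing the ones and dividing by m

module Counting (m : ℕ) .{{nt : NonTrivial m}} where

  instance
    m≢0 : NonZero m
    m≢0 = nonTrivial⇒nonZero m

  inflate : ℕ → List ℕ → List ℕ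
  inflate a qs = map (m *_) qs ++ replicate a 1

  m*q≢1 : ∀ q → ¬ (m * q ≡ 1)
  m*q≢1 q eq = <⇒≢ (nonTrivial⇒n>1 m) (sym (m*n≡1⇒m≡1 m q eq))

  m^k>0 : ∀ k → 0 < m ^ k
  m^k>0 k = ≤-<-trans z≤n (k<m^k m k)

  sum-inflate : ∀ a qs → sum (inflate a qs) ≡ m * sum qs + a
  sum-inflate a qs = trans (sum-++ (map (m *_) qs) (replicate a 1))
    (cong₂ _+_ (sum-map-* m qs) (sum-replicate-1 a))

  -- Since 1 is not a multiple of `m`, the scaled parts end where the ones begin. The counts `a` and
  -- `b` may differ, as `complete` lets them depend on the list.
  inflate-injective : ∀ a b ps qs → inflate a ps ≡ inflate b qs → ps ≡ qs
  inflate-injective a       b       []       []       eq = refl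
  inflate-injective (suc a) b       []       (q ∷ qs) eq =
    ⊥-elim (m*q≢1 q (sym (proj₁ (∷-injective eq))))
  inflate-injective a       (suc b) (p ∷ ps) []       eq =
    ⊥-elim (m*q≢1 p (proj₁ (∷-injective eq)))
  inflate-injective a       b       (p ∷ ps) (q ∷ qs) eq =
    cong₂ _∷_ (*-cancelˡ-≡ p q m (proj₁ (∷-injective eq)))
              (inflate-injective a b ps qs (proj₂ (∷-injective eq)))

  inflate-decreasing : ∀ a {qs} → All (0 <_) qs → AllPairs _≥_ qs → AllPairs _≥_ (inflate a qs)
  inflate-decreasing a {qs} qs>0 qs≥ = AllPairsₚ.++⁺
    (AllPairsₚ.map⁺ (AllPairs.map (*-monoʳ-≤ m) qs≥))
    (replicate-≥ a 1)
    (Allₚ.map⁺ (All.map (λ q>0 → Allₚ.replicate⁺ a (m*q>0 q>0)) qs>0))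
    where
    m*q>0 : ∀ {q} → 0 < q → 0 < m * q
    m*q>0 {q} q>0 = <-≤-trans q>0 (m≤n*m q m)

  ∈-inflate-*⁻ : ∀ a {q} qs → m * q ∈ inflate a qs → q ∈ qs
  ∈-inflate-*⁻ a {q} qs mq∈ with ∈-++⁻ (map (m *_) qs) mq∈
  ... | inj₂ mq∈1 = ⊥-elim (m*q≢1 q (∈-replicate⁻ a mq∈1))
  ... | inj₁ mq∈m with ∈-map⁻ (m *_) mq∈m
  ...   | q′ , q′∈ , eq = subst (_∈ qs) (sym (*-cancelˡ-≡ q q′ m eq)) q′∈

  All≤-inflate⁻ : ∀ a {q qs} → All (_≤ m * q) (inflate a qs) → All (_≤ q) qs
  All≤-inflate⁻ a {q} {qs} p =
    All.map (*-cancelˡ-≤ m) (Allₚ.map⁻ (Allₚ.++⁻ˡ (map (m *_) qs) p))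

  -- In decreasing order, everything after the first 1 is a power of `m` that is at most 1, hence 1;
  -- every part before it is a multiple of `m`.
  deflate : ∀ {ps} → All (IsPowerOf m) ps → AllPairs _≥_ ps →
    ∃₂ λ a qs → ps ≡ inflate a qs × All (IsPowerOf m) qs × AllPairs _≥_ qs
  deflate [] [] = 0 , [] , refl , [] , []
  deflate {p ∷ ps} ((zero , refl) ∷ pows) (ps≤1 ∷ _) =
    suc (length ps) , [] , cong (1 ∷_) (All-1⇒replicate (All.zipWith power≤1 (pows , ps≤1))) , [] , []
    where
    power≤1 : ∀ {p} → IsPowerOf m p × p ≤ 1 → p ≡ 1
    power≤1 ((k , refl) , p≤1) = ≤-antisym p≤1 (m^k>0 k)
  deflate ((suc k , refl) ∷ pows) (ps≤ ∷ ps≥) with deflate pows ps≥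
  ... | a , qs , refl , qpows , qs≥ =
    a , m ^ k ∷ qs , refl , (k , refl) ∷ qpows , All≤-inflate⁻ a ps≤ ∷ qs≥

  1∈gapFree : ∀ {N ps} → 0 < N → IsGapFreeMAryPartition m N ps → 1 ∈ ps
  1∈gapFree {ps = []} N>0 g = ⊥-elim (<⇒≢ N>0 (total (isPartition g)))
  1∈gapFree {ps = p ∷ ps} N>0 g with mary g
  ... | (zero  , eq)   ∷ _ = here (sym eq)
  ... | (suc i , refl) ∷ _ = withoutGaps g (suc i)
    (greatest (Linked⇒AllPairs (flip ≤-trans) (decreasing (isPartition g)))) 0 (s≤s z≤n)

  -- Scaling shifts all exponents up by one, and so the gap condition too; the new exponent 0 is
  -- supplied by the ones, whence `0 < a`.
  inflate-gapFree : ∀ {a k qs} → 0 < a → IsGapFreeMAryPartition m k qs →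
    IsGapFreeMAryPartition m (m * k + a) (inflate a qs)
  inflate-gapFree {a} {qs = qs} a>0 (mkGapFree (mkPartition qs>0 qs≥ refl) pows gaps) = mkGapFree
    (mkPartition (All.map (λ { (k , refl) → m^k>0 k }) pows′)
      (AllPairs⇒Linked (inflate-decreasing a qs>0 (Linked⇒AllPairs (flip ≤-trans) qs≥)))
      (sum-inflate a qs))
    pows′ gaps′
    where
    pows′ : All (IsPowerOf m) (inflate a qs)
    pows′ = Allₚ.++⁺ (Allₚ.map⁺ (All.map (λ { (k , refl) → suc k , refl }) pows))
                     (Allₚ.replicate⁺ a (0 , refl))
    gaps′ : WithoutGaps m (inflate a qs)
    gaps′ (suc i) _ zero _ = ∈-++⁺ʳ (map (m *_) qs) (∈-replicate⁺ a>0)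
    gaps′ (suc i) (∈ps , ps≤) (suc k) (s≤s k<i) = ∈-++⁺ˡ (∈-map⁺ (m *_)
      (gaps i (∈-inflate-*⁻ a qs ∈ps , All≤-inflate⁻ a ps≤) k k<i))

  deflate-gapFree : ∀ {N ps} → 0 < N → IsGapFreeMAryPartition m N ps →
    ∃₂ λ a qs → 0 < a × m * sum qs + a ≡ N × ps ≡ inflate a qs ×
      IsGapFreeMAryPartition m (sum qs) qs
  deflate-gapFree N>0 g
    with deflate (mary g) (Linked⇒AllPairs (flip ≤-trans) (decreasing (isPartition g)))
  ... | a , qs , refl , pows , qs≥ =
    a , qs , a>0 (1∈gapFree N>0 g) , trans (sym (sum-inflate a qs)) (total (isPartition g)) , refl ,
    mkGapFree
      (mkPartition (All.map (λ { (k , refl) → m^k>0 k }) pows) (AllPairs⇒Linked qs≥) refl)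
      pows gaps
    where
    a>0 : ∀ {a} → 1 ∈ inflate a qs → 0 < a
    a>0 {suc a} _ = s≤s z≤n
    a>0 {zero} 1∈ with ∈-++⁻ (map (m *_) qs) 1∈
    ... | inj₁ 1∈m with ∈-map⁻ (m *_) 1∈m
    ...   | q , _ , eq = ⊥-elim (m*q≢1 q (sym eq))
    gaps : WithoutGaps m qs
    gaps i (∈qs , qs≤) k k<i = ∈-inflate-*⁻ a qs
      (withoutGaps g (suc i)
        (∈-++⁺ˡ (∈-map⁺ (m *_) ∈qs) , Allₚ.++⁺ (Allₚ.map⁺ (All.map (*-monoʳ-≤ m) qs≤))
                                         (Allₚ.replicate⁺ a (m^k>0 (suc i))))
        (suc k) (s≤s k<i))

  -- Partial sums of c and the recurrence

  -- All totals below `n` are collected because the number of ones removed varies. The empty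
  -- partition of 0 is included.
  gapFreePartitions< : ℕ → List (List ℕ)
  gapFreePartitions< zero    = []
  gapFreePartitions< (suc n) = gapFreePartitions< n ++ gapFreePartitions m n

  ∈-gapFreePartitions<⁻ : ∀ n {qs} → qs ∈ gapFreePartitions< n →
    sum qs < n × IsGapFreeMAryPartition m (sum qs) qs
  ∈-gapFreePartitions<⁻ (suc n) {qs} qs∈ with ∈-++⁻ (gapFreePartitions< n) qs∈
  ... | inj₁ qs∈< = let sum<n , g = ∈-gapFreePartitions<⁻ n qs∈< in m<n⇒m<1+n sum<n , g
  ... | inj₂ qs∈n with Equivalence.to (∈-gapFreePartitions m n qs) qs∈n
  ...   | g@(mkGapFree (mkPartition _ _ refl) _ _) = ≤-refl , g

  ∈-gapFreePartitions<⁺ : ∀ {n k qs} → k < n → IsGapFreeMAryPartition m k qs →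
    qs ∈ gapFreePartitions< n
  ∈-gapFreePartitions<⁺ {suc n} {k} {qs} k<1+n g with m<1+n⇒m<n∨m≡n k<1+n
  ... | inj₁ k<n  = ∈-++⁺ˡ (∈-gapFreePartitions<⁺ k<n g)
  ... | inj₂ refl = ∈-++⁺ʳ (gapFreePartitions< n) (Equivalence.from (∈-gapFreePartitions m k qs) g)

  gapFreePartitions<-unique : ∀ n → Unique (gapFreePartitions< n)
  gapFreePartitions<-unique zero    = []
  gapFreePartitions<-unique (suc n) = Uniqueₚ.++⁺ (gapFreePartitions<-unique n)
    (gapFreePartitions-unique m n)
    λ {qs} (qs∈< , qs∈n) → <⇒≢ (proj₁ (∈-gapFreePartitions<⁻ n qs∈<))
      (total (isPartition (Equivalence.to (∈-gapFreePartitions m n qs) qs∈n)))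

  S : ℕ → ℕ
  S zero    = 0
  S (suc n) = S n + c m n

  length-gapFreePartitions< : ∀ n → length (gapFreePartitions< n) ≡ S n
  length-gapFreePartitions< zero    = refl
  length-gapFreePartitions< (suc n) = trans (length-++ (gapFreePartitions< n))
    (cong (_+ c m n) (length-gapFreePartitions< n))

  c-recurrence : ∀ n t → t < m → c m (m * n + suc t) ≡ S (suc n)
  c-recurrence n t t<m = begin
    c m N                                                ≡⟨ ↭-length perm ⟩
    length (map complete (gapFreePartitions< (suc n)))   ≡⟨ length-map complete (gapFreePartitions< (suc n)) ⟩
    length (gapFreePartitions< (suc n))                  ≡⟨ length-gapFreePartitions< (suc n) ⟩
    S (suc n)                                            ∎
    where
    open ≡-Reasoning
    N : ℕ
    N = m * n + suc t

    -- The total `N` forces the number of ones; by `m*k<N` the subtraction is not truncated and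
    -- leaves at least one.
    complete : List ℕ → List ℕ
    complete qs = inflate (N ∸ m * sum qs) qs

    m*k<N : ∀ {k} → k < suc n → m * k < N
    m*k<N {k} (s≤s k≤n) = ≤-<-trans (*-monoʳ-≤ m k≤n) (m<m+n (m * n) (s≤s z≤n))

    N>0 : 0 < N
    N>0 = ≤-<-trans z≤n (m*k<N (≤-refl {suc n}))

    to : ∀ {ps} → ps ∈ gapFreePartitions m N → ps ∈ map complete (gapFreePartitions< (suc n))
    to {ps} ps∈ with deflate-gapFree N>0 (Equivalence.to (∈-gapFreePartitions m N ps) ps∈)
    ... | a , qs , a>0 , eq , refl , g = subst (_∈ map complete (gapFreePartitions< (suc n)))
      (cong (flip inflate qs) (trans (cong (_∸ m * sum qs) (sym eq)) (m+n∸m≡n (m * sum qs) a)))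
      (∈-map⁺ complete (∈-gapFreePartitions<⁺ (*-cancelˡ-< m (sum qs) (suc n) bound) g))
      where
      -- As `0 < a` and `t < m`, m · sum qs < N ≤ m(n + 1).
      bound : m * sum qs < m * suc n
      bound = <-≤-trans (m<m+n (m * sum qs) a>0) (≤-trans (≤-reflexive eq)
        (≤-trans (+-monoʳ-≤ (m * n) t<m) (≤-reflexive (trans (+-comm (m * n) m) (sym (*-suc m n))))))

    from : ∀ {ps} → ps ∈ map complete (gapFreePartitions< (suc n)) → ps ∈ gapFreePartitions m N
    from {ps} ps∈ with ∈-map⁻ complete ps∈
    ... | qs , qs∈ , refl =
      let k<1+n , g = ∈-gapFreePartitions<⁻ (suc n) qs∈ in
      Equivalence.from (∈-gapFreePartitions m N ps)
        (subst (λ N′ → IsGapFreeMAryPartition m N′ ps) (m+[n∸m]≡n (<⇒≤ (m*k<N k<1+n)))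
          (inflate-gapFree (m<n⇒0<n∸m (m*k<N k<1+n)) g))

    -- Two lists without repetition and with the same members are permutations of each other.
    perm = ∼bag⇒↭ (unique∧set⇒bag (gapFreePartitions-unique m N)
      (Uniqueₚ.map⁺ (inflate-injective _ _ _ _) (gapFreePartitions<-unique (suc n)))
      (mk⇔ to from))

  -- Partial sums modulo m

  suc-pred-m : suc (m ∸ 1) ≡ m
  suc-pred-m = m+[n∸m]≡n (<⇒≤ (nonTrivial⇒n>1 m))

  *-suc′ : ∀ n → m * suc n ≡ m * n + suc (m ∸ 1)
  *-suc′ n = trans (*-suc m n) (trans (+-comm m (m * n)) (cong (_+_ (m * n)) (sym suc-pred-m)))

  -- The additional terms c(mn + 1), ..., c(mn + t) all equal `S (suc n)`.
  S-block : ∀ n t → t ≤ m → S (m * n + suc t) ≡ S (m * n + 1) + t * S (suc n)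
  S-block n zero    _   = sym (+-identityʳ _)
  S-block n (suc t) t<m = begin
    S (m * n + suc (suc t))                              ≡⟨ cong S (+-suc (m * n) (suc t)) ⟩
    S (m * n + suc t) + c m (m * n + suc t)              ≡⟨ cong₂ _+_ (S-block n t (<⇒≤ t<m)) (c-recurrence n t t<m) ⟩
    S (m * n + 1) + t * S (suc n) + S (suc n)            ≡⟨ +-assoc (S (m * n + 1)) _ _ ⟩
    S (m * n + 1) + (t * S (suc n) + S (suc n))          ≡⟨ cong (_+_ (S (m * n + 1))) (+-comm (t * S (suc n)) _) ⟩
    S (m * n + 1) + suc t * S (suc n)                    ∎
    where open ≡-Reasoning

  -- A full block, t = m, adds a multiple of `m`, so the residue stays that of `S 1`, which is c(0)
  -- = 1.
  S-block-start : ∀ n → ∃ λ y → S (m * n + 1) ≡ 1 + m * y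
  S-block-start zero    = 0 , trans (cong (λ k → S (k + 1)) (*-zeroʳ m)) (cong suc (sym (*-zeroʳ m)))
  S-block-start (suc n) = let y , eq = S-block-start n in y + S (suc n) , (begin
    S (m * suc n + 1)                  ≡⟨ cong S (trans (+-comm (m * suc n) 1)
      (cong suc (trans (*-suc m n) (+-comm m (m * n))))) ⟩
    S (suc (m * n + m))                ≡⟨ cong S (+-suc (m * n) m) ⟨
    S (m * n + suc m)                  ≡⟨ S-block n m ≤-refl ⟩
    S (m * n + 1) + m * S (suc n)      ≡⟨ cong (_+ m * S (suc n)) eq ⟩
    1 + (m * y + m * S (suc n))        ≡⟨ cong suc (*-distribˡ-+ m y (S (suc n))) ⟨
    1 + m * (y + S (suc n))            ∎)
    where open ≡-Reasoning

  S-mod : ∀ n t → t ≤ m → + S (m * n + suc t) ≡ 1ℤ ℤ.+ + t ℤ.* + S (suc n) [mod m ]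
  S-mod n t t≤m = let y , eq = S-block-start n in divides (+ y) (begin
    + S (m * n + suc t) ℤ.- r                      ≡⟨ cong (λ x → + x ℤ.- r) (trans (S-block n t t≤m) (cong (_+ t * S (suc n)) eq)) ⟩
    1ℤ ℤ.+ + (m * y) ℤ.+ + (t * S (suc n)) ℤ.- r   ≡⟨ cong₂ (λ a b → 1ℤ ℤ.+ a ℤ.+ b ℤ.- r) (ℤₚ.pos-* m y) (ℤₚ.pos-* t (S (suc n))) ⟩
    1ℤ ℤ.+ + m ℤ.* + y ℤ.+ + t ℤ.* + S (suc n) ℤ.- r ≡⟨ cancel (+ m) (+ y) (+ t) (+ S (suc n)) ⟩
    + y ℤ.* + m                                    ∎)
    where
    open ≡-Reasoning
    r = 1ℤ ℤ.+ + t ℤ.* + S (suc n)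
    cancel : ∀ m y t s → 1ℤ ℤ.+ m ℤ.* y ℤ.+ t ℤ.* s ℤ.- (1ℤ ℤ.+ t ℤ.* s) ≡ y ℤ.* m
    cancel = solve-∀

  -- Stripping base m digits

  S-mod-at : ∀ {u k w} n t → t ≤ m → u ≡ m * n + suc t → k ≡ suc n → w ≡ + t →
    + S u ≡ 1ℤ ℤ.+ w ℤ.* + S k [mod m ]
  S-mod-at n t t≤m refl refl refl = S-mod n t t≤m

  -- The argument on the left is mn + t + 1 with t = s - 1 + carry p, which is `factor p s`; so
  -- `S-mod` applies unless t = -1.
  S-digit : ∀ n p s → s < m → 0 < m * n + s →
    + S (m * n + s + carry p) ≡ 1ℤ ℤ.+ factor p s ℤ.* + S (n + carry s) [mod m ]
  -- Here t = 0: the vanishing factor hides that `carry s` gives `S n`, not `S (suc n)`.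
  S-digit n (suc p) zero    _   _ = subst (λ u → + S (u + 1) ≡ 1ℤ [mod m ])
    (sym (+-identityʳ (m * n))) (S-mod n 0 z≤n)
  S-digit n (suc p) (suc s) s<m _ = S-mod-at n (suc s) (<⇒≤ s<m)
    (trans (+-assoc (m * n) (suc s) 1) (cong (_+_ (m * n)) (+-comm (suc s) 1))) (+-comm n 1)
    (ℤₚ.+-identityʳ (+ suc s))
  S-digit n zero    (suc s) s<m _ = S-mod-at n s (<⇒≤ (<-trans (n<1+n s) s<m))
    (+-identityʳ _) (+-comm n 1) refl
  -- The congruence would read 0 ≡ 1 here, as `S 0` is 0; positivity excludes the case.
  S-digit zero    zero zero _ mn+s>0 =
    ⊥-elim (<⇒≢ mn+s>0 (sym (trans (+-identityʳ (m * 0)) (*-zeroʳ m))))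
  -- The block before m(n+1) ends with t = m − 1, and m − 1 ≡ −1.
  S-digit (suc n) zero zero _ _ = slope-mod
    (+ S (m * suc n + 0 + 0)) (+ S (suc n + 0)) (+ (m ∸ 1)) (ℤ.- 1ℤ)
    (S-mod-at n (m ∸ 1) (m∸n≤m m 1)
      (trans (+-identityʳ _) (trans (+-identityʳ _) (*-suc′ n))) (+-identityʳ (suc n)) refl)
    (divides 1ℤ (trans (cong +_ (trans (+-comm (m ∸ 1) 1) suc-pred-m)) (sym (ℤₚ.*-identityˡ (+ m)))))

  -- Each `S-digit` step turns the carry of one digit into a factor and passes on the carry of the
  -- next, so the induction must include the carry.
  S-horner : ∀ j α → 0 < α j → (∀ i → i ≤ j → α i < m) →
    + S (value m j (α ∘ suc) + carry (α 0)) ≡ horner j (factors α) [mod m ]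
  S-horner zero α α0>0 _ with α 0
  -- No digits are left and the positive leading digit carries: `S 1` computes to 1.
  ... | suc _ = divides (+ 0) refl
  S-horner (suc j) α αj>0 α<m =
    affine-mod
      (+ S (value m (suc j) (α ∘ suc) + carry (α 0))) (+ S (value m j (α ∘ suc ∘ suc) + carry (α 1)))
      (horner j (factors (α ∘ suc))) (factor (α 0) (α 1))
      (S-digit (value m j (α ∘ suc ∘ suc)) (α 0) (α 1) (α<m 1 (s≤s z≤n)) (value>0 m j (α ∘ suc) αj>0))
      (S-horner j (α ∘ suc) αj>0 (λ i i≤j → α<m (suc i) (s≤s i≤j)))

  -- A positive multiple of `m` ends the block of the preceding multiple: t = m - 1.
  c-multiple : ∀ {n} → 0 < n → c m (m * n) ≡ S n
  c-multiple {suc n} _ = trans (cong (c m) (*-suc′ n)) (c-recurrence n (m ∸ 1) (≤-reflexive suc-pred-m))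

-- From the Horner form to the sum of products

theorem1p4 : ∀ (m : ℕ) .{{_ : NonTrivial m}} (n j : ℕ) (α : ℕ → ℕ) →
    0 < n →
    m ^ j ≤ n → n < m ^ suc j →
    n ≡ ∑⟨0⋯ j ⟩ (λ i → α i * m ^ i) →
    0 < α j →
    (∀ i → i ≤ j → α i < m) →
    + c m (m * n) ≡
    + α 0 ℤ.+ (+ α 0 ℤ.- 1ℤ) ℤ.* ∑⟨1⋯ j ⟩ (λ i → ∏⟨1⋯ i ⟩ (λ k → + α k ℤ.- χ α k))
    [mod m ]
theorem1p4 m n j α n>0 _ _ n≡∑ αj>0 α<m = subst (_≡ rhs [mod m ]) (sym lhs≡)
  (subst (+ S (value m (suc j) α + 0) ≡_[mod m ]) rhs≡
    (affine-mod (+ S (value m (suc j) α + 0)) (+ S (value m j (α ∘ suc) + carry (α 0)))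
      (horner j (factors α)) (+ α 0 ℤ.- 1ℤ)
      -- α₀ − 1 is the factor of the units digit, no digit preceding it.
      (S-digit (value m j (α ∘ suc)) 0 (α 0) (α<m 0 z≤n) (value>0 m j α αj>0))
      (S-horner j α αj>0 α<m)))
  where
  instance
    m≢0′ : NonZero m
    m≢0′ = nonTrivial⇒nonZero m
  open Counting m
  open ≡-Reasoning
  rhs = + α 0 ℤ.+ (+ α 0 ℤ.- 1ℤ) ℤ.* ∑⟨1⋯ j ⟩ (λ i → ∏⟨1⋯ i ⟩ (λ k → + α k ℤ.- χ α k))

  -- The summand 0 is `carry 0`, from a fictitious digit 0 below the units digit.
  lhs≡ : + c m (m * n) ≡ + S (value m (suc j) α + 0)
  lhs≡ = cong +_ (trans (c-multiple n>0) (cong S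
    (trans n≡∑ (trans (value-∑ m (suc j) α) (sym (+-identityʳ _))))))

  regroup : ∀ a x → 1ℤ ℤ.+ (a ℤ.- 1ℤ) ℤ.* (1ℤ ℤ.+ x) ≡ a ℤ.+ (a ℤ.- 1ℤ) ℤ.* x
  regroup = solve-∀

  rhs≡ : 1ℤ ℤ.+ (+ α 0 ℤ.- 1ℤ) ℤ.* horner j (factors α) ≡ rhs
  rhs≡ = begin
    1ℤ ℤ.+ (+ α 0 ℤ.- 1ℤ) ℤ.* horner j (factors α)
      ≡⟨ cong (λ h → 1ℤ ℤ.+ (+ α 0 ℤ.- 1ℤ) ℤ.* h) (horner-∑∏ j (factors α)) ⟨
    1ℤ ℤ.+ (+ α 0 ℤ.- 1ℤ) ℤ.* (1ℤ ℤ.+ Σℤ.sum {j} (λ i → Πℤ.sum {suc (toℕ i)} (λ k → factors α (toℕ k))))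
      ≡⟨ regroup (+ α 0) _ ⟩
    + α 0 ℤ.+ (+ α 0 ℤ.- 1ℤ) ℤ.* Σℤ.sum {j} (λ i → Πℤ.sum {suc (toℕ i)} (λ k → factors α (toℕ k)))
      ≡⟨ cong (λ s → + α 0 ℤ.+ (+ α 0 ℤ.- 1ℤ) ℤ.* s) (Σℤ.sum-cong-≗ {j} (λ i → Πℤ.sum-cong-≗ {suc (toℕ i)} (λ k →
           cong (ℤ._-_ (+ α (suc (toℕ k)))) (sym (χ-carry α (toℕ k)))))) ⟩
    rhs ∎
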